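{- Let $k\ge 0$ be an integer. Every graph with degeneracy $k$ is $(k+1)$-paintable.
   Context: Graphs are finite, simple and undirected. The (classical) on-line list colouring game is played by Mr. Paint and Mrs. Correct on a graph $G$ known to both, with an assignment of erasers $\ell: V(G)\to\{0,1,2,\dots\}$; initially all vertices are uncoloured. In each round Mr. Paint takes a new colour (never used before and never to be used again) and colours with it a nonempty set $V_P$ of currently uncoloured vertices (adjacent vertices are allowed). Mrs. Correct then chooses a subset $V_C\subseteq V_P$ and removes the colour from the vertices in $V_C$; this consumes one eraser at each vertex of $V_C$, so each of them must have at least one eraser remaining. The set $V_P\setminus V_C$, whose vertices stay coloured permanently, must be independent in $G$. If Mrs. Correct cannot make such a choice because she has run out of erasers at some vertex, Mr. Paint wins; if all of $G$ becomes (properly) coloured, Mrs. Correct wins. The graph $G$ is $\ell$-paintable if Mrs. Correct has a winning strategy. For an integer $k\ge 1$, $G$ is $k$-paintable if it is $\ell$-paintable for the assignment giving $k-1$ erasers to every vertex. -}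

module Defs where

open import Data.Bool.Base using (if_then_else_)
open import Data.Fin.Base using (Fin)
open import Data.Fin.Subset
  using (Subset; _∈_; _∉_; _⊆_; _─_; ⊤; ∣_∣; Nonempty; Empty)
open import Data.Nat.Base using (ℕ; pred; _≤_; NonZero)
open import Data.Product.Base using (∃-syntax; _×_)
open import Data.Vec.Base using (lookup)

-- Finite simple undirected graphs on the vertex set Fin n, presented by the
-- neighbourhood of each vertex: u and v are adjacent when v ∈ N u.
record Graph (n : ℕ) : Set where
  field
    N        : Fin n → Subset n
    N-sym    : ∀ {u v} → v ∈ N u → u ∈ N v
    N-irrefl : ∀ {v} → v ∉ N v

  degree : Fin n → ℕ
  degree v = ∣ N v ∣

-- Subgraphs need not be induced.  The edges are given as a graph on all of
-- Fin n in which every vertex outside `vertices` is isolated (for the other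
-- endpoint of an edge this follows from symmetry).
record Subgraph {n : ℕ} (G : Graph n) : Set where
  field
    vertices  : Subset n
    edges     : Graph n
    edges⊆    : ∀ u → Graph.N edges u ⊆ Graph.N G u
    endpoints : ∀ {u v} → v ∈ Graph.N edges u → v ∈ vertices

  open Graph edges public using (degree)

Degenerate : {n : ℕ} → ℕ → Graph n → Set
Degenerate k G = (H : Subgraph G) → Nonempty (Subgraph.vertices H) →
  ∃[ v ] v ∈ Subgraph.vertices H × Subgraph.degree H v ≤ k

-- "G has degeneracy k": k is the least number for which G is k-degenerate
-- (hence 0 for the graph without vertices).
HasDegeneracy : {n : ℕ} → Graph n → ℕ → Set
HasDegeneracy G k = Degenerate k G × (∀ j → Degenerate j G → k ≤ j)

Independent : {n : ℕ} → Graph n → Subset n → Set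
Independent G S = ∀ {u v} → u ∈ S → v ∈ S → v ∉ Graph.N G u

Erasers : ℕ → Set
Erasers n = Fin n → ℕ

-- Truncation of pred at 0 is irrelevant: legal choices of C only contain
-- vertices that have an eraser left (see LegalReply).
useErasers : {n : ℕ} → Subset n → Erasers n → Erasers n
useErasers C ℓ v = if lookup C v then pred (ℓ v) else ℓ v

LegalReply : {n : ℕ} → Graph n → Erasers n → (P C : Subset n) → Set
LegalReply G ℓ P C =
  C ⊆ P × (∀ {v} → v ∈ C → 1 ≤ ℓ v) × Independent G (P ─ C)

-- CorrectWins G U ℓ: Mrs. Correct has a winning strategy from the position in
-- which U is the set of uncoloured vertices and ℓ gives the erasers left.
-- An element is a strategy tree; being inductive, it has only finite plays,
-- each ending with all vertices coloured.  The colours already placed are not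
-- recorded: every round uses a fresh colour, so they affect neither the later
-- moves nor properness, and P ─ C is the complete colour class of its round.
data CorrectWins {n : ℕ} (G : Graph n) (U : Subset n) (ℓ : Erasers n) : Set where
  allColoured : Empty U → CorrectWins G U ℓ
  round :
    (∀ P → Nonempty P → P ⊆ U →
      ∃[ C ] LegalReply G ℓ P C × CorrectWins G (U ─ (P ─ C)) (useErasers C ℓ)) →
    CorrectWins G U ℓ

Paintable : {n : ℕ} → Graph n → Erasers n → Set
Paintable G ℓ = CorrectWins G ⊤ ℓ

_-Paintable_ : {n : ℕ} (k : ℕ) .{{_ : NonZero k}} → Graph n → Set
k -Paintable G = Paintable G (λ _ → pred k)

{-# OPTIONS --safe #-}

-- Let every vertex v carry a set out v of neighbours.  A kernel of P is an
-- independent I ⊆ P such that every v ∈ P outside I has a member of out v in I.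
-- If every P has a kernel, Mrs. Correct keeps the colour on a kernel I of P: a
-- vertex that loses an eraser also loses an uncoloured member of out v, so that
-- ∣ out v ∩ U ∣ ≤ ℓ v persists for the uncoloured vertices v ∈ U.
-- In a k-degenerate graph such sets of size ≤ k exist: remove a vertex v of
-- degree ≤ k from S, find the sets out u for S - v, and let out v = N v ∩ S.
-- A kernel of P - v is one of P if it meets out v; otherwise adding v gives one.
module Submission where

open import Defs
open import Data.Bool.Base using (true; false)
open import Data.Empty using (⊥-elim)
open import Data.Fin.Base using (Fin)
open import Data.Fin.Properties using (_≟_)
open import Data.Fin.Subset
open import Data.Fin.Subset.Induction using (Acc; acc; ⊂-wellFounded)
open import Data.Fin.Subset.Properties
open import Data.Nat.Base using (ℕ; suc; pred; _≤_; s≤s; z≤n)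
open import Data.Nat.Properties using (≤-trans; <⇒≤pred)
open import Data.Product.Base using (∃-syntax; _×_; _,_; proj₁; proj₂)
open import Data.Sum.Base using (_⊎_; inj₁; inj₂)
open import Data.Vec.Base using (_∷_; here; there; lookup)
open import Data.Vec.Functional using (updateAt)
open import Data.Vec.Functional.Properties using (updateAt-updates; updateAt-minimal)
open import Data.Vec.Properties using ([]=⇒lookup; lookup⇒[]=)
open import Function.Base using (_∘_; const)
open import Relation.Binary.PropositionalEquality
open import Relation.Nullary.Decidable using (yes; no; decidable-stable)
open import Relation.Nullary.Negation using (contradiction)

private
  variable
    n : ℕ

x∈p─q⇒x∉q : {p q : Subset n} {x : Fin n} → x ∈ p ─ q → x ∉ q
x∈p─q⇒x∉q {p = _ ∷ _} {inside ∷ _} () here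
x∈p─q⇒x∉q {p = _ ∷ _} {_ ∷ _} (there x∈p─q) (there x∈q) = x∈p─q⇒x∉q x∈p─q x∈q

q⊆p⇒p─[p─q]≡q : {p q : Subset n} → q ⊆ p → p ─ (p ─ q) ≡ q
q⊆p⇒p─[p─q]≡q {p = p} {q} q⊆p = ⊆-antisym
  (λ {x} x∈ → decidable-stable (x ∈? q) λ x∉q →
    x∈p─q⇒x∉q x∈ (x∈p∧x∉q⇒x∈p─q (p─q⊆p p (p ─ q) x∈) x∉q))
  (λ x∈q → x∈p∧x∉q⇒x∈p─q (q⊆p x∈q) (λ x∈p─q → x∈p─q⇒x∉q x∈p─q x∈q))

p⊆q⇒p-x⊆q-x : {p q : Subset n} {x : Fin n} → p ⊆ q → p - x ⊆ q - x
p⊆q⇒p-x⊆q-x {p = p} {x = x} p⊆q y∈p-x =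
  x∈p∧x∉q⇒x∈p─q (p⊆q (p─q⊆p p ⁅ x ⁆ y∈p-x)) (x∈p─q⇒x∉q y∈p-x)

x∈p-y⇒x≢y : {p : Subset n} {x y : Fin n} → x ∈ p - y → x ≢ y
x∈p-y⇒x≢y x∈p-y refl = x∈p─q⇒x∉q x∈p-y (x∈⁅x⁆ _)

∩-monoʳ-⊆ : (p : Subset n) {q r : Subset n} → q ⊆ r → p ∩ q ⊆ p ∩ r
∩-monoʳ-⊆ p {q} q⊆r x∈p∩q =
  let x∈p , x∈q = x∈p∩q⁻ p q x∈p∩q in x∈p∩q⁺ (x∈p , q⊆r x∈q)

useErasers-∈ : {C : Subset n} (ℓ : Erasers n) {v : Fin n} →
  v ∈ C → useErasers C ℓ v ≡ pred (ℓ v)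
useErasers-∈ ℓ v∈C rewrite []=⇒lookup v∈C = refl

useErasers-∉ : {C : Subset n} (ℓ : Erasers n) {v : Fin n} →
  v ∉ C → useErasers C ℓ v ≡ ℓ v
useErasers-∉ {C = C} ℓ {v} v∉C with lookup C v in eq
... | true  = contradiction (lookup⇒[]= v C eq) v∉C
... | false = refl

record Kernel (G : Graph n) (out : Fin n → Subset n) (P : Subset n) : Set where
  field
    members     : Subset n
    members⊆    : members ⊆ P
    independent : Independent G members
    absorbing   : ∀ {v} → v ∈ P → v ∉ members → Nonempty (out v ∩ members)

kernels⇒CorrectWins : (G : Graph n) (out : Fin n → Subset n) →
  (∀ P → Kernel G out P) →
  (U : Subset n) (ℓ : Erasers n) → (∀ {v} → v ∈ U → ∣ out v ∩ U ∣ ≤ ℓ v) →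
  CorrectWins G U ℓ
kernels⇒CorrectWins {n} G out kernel U = play U (⊂-wellFounded U)
  where
  play : (U : Subset n) → Acc _⊂_ U →
    (ℓ : Erasers n) → (∀ {v} → v ∈ U → ∣ out v ∩ U ∣ ≤ ℓ v) → CorrectWins G U ℓ
  -- This also settles an empty `U`: there is then no nonempty `P ⊆ U` to answer.
  play U (acc rec) ℓ bound = round reply
    where
    reply : ∀ P → Nonempty P → P ⊆ U →
      ∃[ C ] LegalReply G ℓ P C × CorrectWins G (U ─ (P ─ C)) (useErasers C ℓ)
    reply P (x , x∈P) P⊆U = C , (p─q⊆p P I , eraser-left , kept-independent) ,
      subst (λ J → CorrectWins G (U ─ J) (useErasers C ℓ)) (sym P─C≡I)
        (play (U ─ I) (rec U─I⊂U) (useErasers C ℓ) bound′)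
      where
      open Kernel (kernel P) renaming (members to I)

      -- The kernel is the set that keeps its colour, while a reply names the set that is erased;
      -- `P─C≡I` translates back.
      C : Subset n
      C = P ─ I

      P─C≡I : P ─ C ≡ I
      P─C≡I = q⊆p⇒p─[p─q]≡q members⊆

      kept-independent : Independent G (P ─ C)
      kept-independent = subst (Independent G) (sym P─C≡I) independent

      -- Strictness is witnessed by the vertex of `I` that absorbs `v`: it was uncoloured, since
      -- `I ⊆ P ⊆ U`, and becomes coloured now.
      out-shrinks : ∀ {v} → v ∈ C → out v ∩ (U ─ I) ⊂ out v ∩ U
      out-shrinks {v} v∈C =
        let w , w∈ = absorbing (p─q⊆p P I v∈C) (x∈p─q⇒x∉q v∈C)
            w∈out , w∈I = x∈p∩q⁻ (out v) I w∈
        in ∩-monoʳ-⊆ (out v) (p─q⊆p U I) ,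
           w , x∈p∩q⁺ (w∈out , P⊆U (members⊆ w∈I)) ,
           λ w∈′ → x∈p─q⇒x∉q (p∩q⊆q (out v) (U ─ I) w∈′) w∈I

      -- The `suc` serves twice: it makes erasing at `v` legal, and it pays for the eraser spent
      -- there in `bound′`.
      out-<-erasers : ∀ {v} → v ∈ C → suc ∣ out v ∩ (U ─ I) ∣ ≤ ℓ v
      out-<-erasers v∈C =
        ≤-trans (p⊂q⇒∣p∣<∣q∣ (out-shrinks v∈C)) (bound (P⊆U (p─q⊆p P I v∈C)))

      eraser-left : ∀ {v} → v ∈ C → 1 ≤ ℓ v
      eraser-left v∈C = ≤-trans (s≤s z≤n) (out-<-erasers v∈C)

      -- Needed for termination: at least one vertex is coloured in each round.
      I-nonempty : Nonempty I
      I-nonempty with x ∈? I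
      ... | yes x∈I = x , x∈I
      ... | no  x∉I = let w , w∈ = absorbing x∈P x∉I in w , p∩q⊆q (out x) I w∈

      U─I⊂U : U ─ I ⊂ U
      U─I⊂U = let w , w∈I = I-nonempty in
        p∩q≢∅⇒p─q⊂p U I (w , x∈p∩q⁺ (P⊆U (members⊆ w∈I) , w∈I))

      bound′ : ∀ {v} → v ∈ U ─ I → ∣ out v ∩ (U ─ I) ∣ ≤ useErasers C ℓ v
      bound′ {v} v∈U─I with v ∈? C
      ... | yes v∈C = subst (_ ≤_) (sym (useErasers-∈ ℓ v∈C)) (<⇒≤pred (out-<-erasers v∈C))
      ... | no  v∉C = subst (_ ≤_) (sym (useErasers-∉ ℓ v∉C))
        (≤-trans (p⊆q⇒∣p∣≤∣q∣ (∩-monoʳ-⊆ (out v) (p─q⊆p U I))) (bound (p─q⊆p U I v∈U─I)))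

module _ (G : Graph n) where
  open Graph G using (N; N-sym; N-irrefl)

  -- The value `⊥` outside `S` is there for symmetry: `N u ∩ S` alone would still join an outside
  -- `u` to its neighbours in `S`.
  inducedN : Subset n → Fin n → Subset n
  inducedN S u with u ∈? S
  ... | yes _ = N u ∩ S
  ... | no  _ = ⊥

  inducedN-∈ : {S : Subset n} {u : Fin n} → u ∈ S → inducedN S u ≡ N u ∩ S
  inducedN-∈ {S} {u} u∈S with u ∈? S
  ... | yes _   = refl
  ... | no  u∉S = contradiction u∈S u∉S

  inducedN⁻ : {S : Subset n} {u v : Fin n} → v ∈ inducedN S u → u ∈ S × v ∈ N u × v ∈ S
  inducedN⁻ {S} {u} v∈ with u ∈? S
  ... | yes u∈S = u∈S , x∈p∩q⁻ (N u) S v∈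
  ... | no  _   = contradiction v∈ ∉⊥

  inducedSubgraph : Subset n → Subgraph G
  inducedSubgraph S = record
    { vertices  = S
    ; edges     = record
      { N        = inducedN S
      ; N-sym    = λ {u} {v} v∈ → let u∈S , v∈Nu , v∈S = inducedN⁻ {S} {u} {v} v∈ in
          subst (u ∈_) (sym (inducedN-∈ v∈S)) (x∈p∩q⁺ (N-sym v∈Nu , u∈S))
      ; N-irrefl = λ {v} v∈ → N-irrefl (proj₁ (proj₂ (inducedN⁻ {S} {v} {v} v∈)))
      }
    ; edges⊆    = λ u {v} v∈ → proj₁ (proj₂ (inducedN⁻ {S} {u} {v} v∈))
    ; endpoints = λ {u} {v} v∈ → proj₂ (proj₂ (inducedN⁻ {S} {u} {v} v∈))
    }

  degenerate⇒low-degree : {k : ℕ} → Degenerate k G →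
    (S : Subset n) → Nonempty S → ∃[ v ] v ∈ S × ∣ N v ∩ S ∣ ≤ k
  degenerate⇒low-degree {k} deg S S≢∅ =
    let v , v∈S , d≤k = deg (inducedSubgraph S) S≢∅ in
    v , v∈S , subst (λ p → ∣ p ∣ ≤ k) (inducedN-∈ v∈S) d≤k

  -- A kernel of `P` depends on `out` only through its values on `P`, so redefining `out` at a
  -- removed vertex preserves the kernels of sets avoiding it.
  transportKernel : {out out′ : Fin n → Subset n} {P : Subset n} →
    (∀ {u} → u ∈ P → out′ u ≡ out u) → Kernel G out P → Kernel G out′ P
  transportKernel eq K = record
    { members     = members
    ; members⊆    = members⊆
    ; independent = independent
    ; absorbing   = λ u∈P u∉I →
        subst (λ p → Nonempty (p ∩ members)) (sym (eq u∈P)) (absorbing u∈P u∉I)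
    }
    where open Kernel K

  extendKernel : {out : Fin n → Subset n} {P S : Subset n} {v : Fin n} →
    P ⊆ S → v ∈ P → out v ≡ N v ∩ S → Kernel G out (P - v) → Kernel G out P
  extendKernel {out} {P} {S} {v} P⊆S v∈P out-v K with nonempty? (out v ∩ Kernel.members K)
  ... | yes absorbed = record
    { members     = members
    ; members⊆    = p─q⊆p P ⁅ v ⁆ ∘ members⊆
    ; independent = independent
    ; absorbing   = absorbing′
    }
    where
    open Kernel K
    absorbing′ : ∀ {u} → u ∈ P → u ∉ members → Nonempty (out u ∩ members)
    absorbing′ {u} u∈P u∉I with u ≟ v
    ... | yes refl = absorbed
    ... | no  u≢v  = absorbing (x∈p∧x≢y⇒x∈p-y u∈P u≢v) u∉I
  ... | no free = record
    { members     = I ∪ ⁅ v ⁆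
    ; members⊆    = λ u∈ → members⊆′ (x∈p∪q⁻ I ⁅ v ⁆ u∈)
    ; independent = λ u∈ w∈ → independent′ (x∈p∪q⁻ I ⁅ v ⁆ u∈) (x∈p∪q⁻ I ⁅ v ⁆ w∈)
    ; absorbing   = λ {u} u∈P u∉ →
        let w , w∈ = absorbing
              (x∈p∧x≢y⇒x∈p-y u∈P λ { refl → u∉ (q⊆p∪q I ⁅ v ⁆ (x∈⁅x⁆ v)) })
              (u∉ ∘ p⊆p∪q ⁅ v ⁆)
        in w , ∩-monoʳ-⊆ (out u) (p⊆p∪q ⁅ v ⁆) w∈
    }
    where
    open Kernel K renaming (members to I)

    members⊆′ : ∀ {u} → u ∈ I ⊎ u ∈ ⁅ v ⁆ → u ∈ P
    members⊆′ (inj₁ u∈I) = p─q⊆p P ⁅ v ⁆ (members⊆ u∈I)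
    members⊆′ (inj₂ u∈v) = subst (_∈ P) (sym (x∈⁅y⁆⇒x≡y v u∈v)) v∈P

    -- Here `out v` has to contain every neighbour of `v` in `S`: one lying in `I ⊆ S` would belong
    -- to `out v ∩ I`, which is empty by `free`.
    v-isolated : ∀ {u} → u ∈ I → u ∉ N v
    v-isolated {u} u∈I u∈Nv = free (u , x∈p∩q⁺
      ( subst (u ∈_) (sym out-v) (x∈p∩q⁺ (u∈Nv , P⊆S (members⊆′ (inj₁ u∈I))))
      , u∈I))

    independent′ : ∀ {u w} → u ∈ I ⊎ u ∈ ⁅ v ⁆ → w ∈ I ⊎ w ∈ ⁅ v ⁆ → w ∉ N u
    independent′ (inj₁ u∈I) (inj₁ w∈I) = independent u∈I w∈I
    independent′ (inj₁ u∈I) (inj₂ w∈v) rewrite x∈⁅y⁆⇒x≡y v w∈v = v-isolated u∈I ∘ N-sym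
    independent′ (inj₂ u∈v) (inj₁ w∈I) rewrite x∈⁅y⁆⇒x≡y v u∈v = v-isolated w∈I
    independent′ (inj₂ u∈v) (inj₂ w∈v)
      rewrite x∈⁅y⁆⇒x≡y v u∈v | x∈⁅y⁆⇒x≡y v w∈v = N-irrefl

  -- A single `out` has to serve all `P`, because the bound on erasers refers to the same sets
  -- throughout the game.
  degenerate⇒kernels : {k : ℕ} → Degenerate k G → (S : Subset n) →
    ∃[ out ] (∀ {v} → v ∈ S → ∣ out v ∣ ≤ k) × (∀ P → P ⊆ S → Kernel G out P)
  degenerate⇒kernels {k} deg S = build S (⊂-wellFounded S)
    where
    build : (S : Subset n) → Acc _⊂_ S →
      ∃[ out ] (∀ {v} → v ∈ S → ∣ out v ∣ ≤ k) × (∀ P → P ⊆ S → Kernel G out P)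
    build S (acc rec) with nonempty? S
    ... | no S≡∅ = const ⊥ , (λ v∈S → ⊥-elim (S≡∅ (_ , v∈S))) , λ P P⊆S → record
      { members     = ⊥
      ; members⊆    = ⊥⊆
      ; independent = λ u∈⊥ → contradiction u∈⊥ ∉⊥
      ; absorbing   = λ v∈P → ⊥-elim (S≡∅ (_ , P⊆S v∈P))
      }
    ... | yes S≢∅ = out , small , kernel
      where
      low = degenerate⇒low-degree deg S S≢∅
      v   = proj₁ low
      v∈S = proj₁ (proj₂ low)

      previous = build (S - v) (rec (x∈p⇒p-x⊂p v∈S))
      out₀     = proj₁ previous

      -- Each vertex points to its neighbours that are still present when it is removed; the values
      -- chosen for `S - v` are kept.
      out : Fin n → Subset n
      out = updateAt out₀ v (const (N v ∩ S))

      out-v : out v ≡ N v ∩ S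
      out-v = updateAt-updates v out₀

      out-≢v : ∀ {u} → u ≢ v → out u ≡ out₀ u
      out-≢v {u} = updateAt-minimal u v out₀

      small : ∀ {u} → u ∈ S → ∣ out u ∣ ≤ k
      small {u} u∈S with u ≟ v
      ... | yes refl = subst (λ p → ∣ p ∣ ≤ k) (sym out-v) (proj₂ (proj₂ low))
      ... | no  u≢v  = subst (λ p → ∣ p ∣ ≤ k) (sym (out-≢v u≢v))
        (proj₁ (proj₂ previous) (x∈p∧x≢y⇒x∈p-y u∈S u≢v))

      kernel-avoiding-v : ∀ P → P ⊆ S - v → Kernel G out P
      kernel-avoiding-v P P⊆S-v = transportKernel (λ u∈P → out-≢v (x∈p-y⇒x≢y (P⊆S-v u∈P)))
        (proj₂ (proj₂ previous) P P⊆S-v)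

      kernel : ∀ P → P ⊆ S → Kernel G out P
      kernel P P⊆S with v ∈? P
      ... | yes v∈P = extendKernel P⊆S v∈P out-v
        (kernel-avoiding-v (P - v) (p⊆q⇒p-x⊆q-x P⊆S))
      ... | no  v∉P = kernel-avoiding-v P λ u∈P →
        x∈p∧x≢y⇒x∈p-y (P⊆S u∈P) λ { refl → v∉P u∈P }

theorem3 : (n : ℕ) (G : Graph n) (k : ℕ) → HasDegeneracy G k → (suc k) -Paintable G
theorem3 n G k (deg , _) =
  let out , small , kernel = degenerate⇒kernels G deg ⊤ in
  -- Being `suc k`-paintable means `k` erasers at each vertex, exactly the bound on the sizes of the
  -- sets `out v`.
  kernels⇒CorrectWins G out (λ P → kernel P ⊆⊤) ⊤ (λ _ → k)
    (λ {v} v∈⊤ → ≤-trans (∣p∩q∣≤∣p∣ (out v) ⊤) (small v∈⊤))
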